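{- Let $G$ be a parallel superedge with terminals $s$ and $t$, i.e. an oriented parallel superedge $(G,s,t)$ with principal subgraphs $G_1,\dots,G_k$, each non-parallel. Suppose there is a permutation $\tau\in S_k$ and, for each $1\le i\le k$, a graph isomorphism $r_i:G_i\to G_{\tau(i)}$ with $r_i(s)=t$ and $r_i(t)=s$; let $r:V(G)\to V(G)$ be the map whose restriction to $V(G_i)$ is $r_i$ for each $i$. Then $\mathrm{Aut}_{\mathrm{semi}}(G,\{s,t\})=\{\sigma,\ r\sigma:\sigma\in\mathrm{Aut}_{\mathrm{or}}(G,s,t)\}$. If no such permutation and isomorphisms exist, then $\mathrm{Aut}_{\mathrm{semi}}(G,\{s,t\})=\mathrm{Aut}_{\mathrm{or}}(G,s,t)$.
   Context: All graphs are finite, simple and undirected. An oriented series-parallel graph is a triple $(G,s,t)$ where $G$ is a graph and $s\neq t$ are vertices, defined recursively: (i) $G$ is a single edge with vertex set $\{s,t\}$; or (ii) (serial superedge) there are $k\ge 2$ oriented series-parallel graphs $(G_1,s_1,t_1),\dots,(G_k,s_k,t_k)$ with $s_1=s$, $t_k=t$, $t_i=s_{i+1}$ for $1\le i<k$, $V(G_i)\cap V(G_{i+1})=\{s_{i+1}\}$, $V(G_i)\cap V(G_j)=\emptyset$ for $|i-j|\ge2$, and $G=G_1\cup\dots\cup G_k$; or (iii) (parallel superedge) there are $k\ge2$ oriented series-parallel graphs $(G_1,s,t),\dots,(G_k,s,t)$ with $V(G_i)\cap V(G_j)=\{s,t\}$ for $i\neq j$ and $G=G_1\cup\dots\cup G_k$.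 The $G_i$ are the principal subgraphs; a graph is non-parallel if it is not a parallel superedge. $\mathrm{Aut}_{\mathrm{or}}(G,s,t)$ is the group of automorphisms $\sigma$ of $G$ with $\sigma(s)=s$, $\sigma(t)=t$; $\mathrm{Aut}_{\mathrm{semi}}(G,\{s,t\})$ is the group of automorphisms $\sigma$ of $G$ with $\{\sigma(s),\sigma(t)\}=\{s,t\}$. -}

module Defs where

open import Data.Empty using (⊥)
open import Data.Fin using (Fin; zero; suc; toℕ; fromℕ; inject₁)
open import Data.Fin.Permutation using (Permutation′; _⟨$⟩ʳ_)
open import Data.Fin.Subset using (Subset; _∈_; _∉_; _∩_; _∪_; ⁅_⁆)
  renaming (⊥ to ∅)
open import Data.Fin.Subset.Properties using (x∈⁅x⁆; p⊆p∪q; q⊆p∪q)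
open import Data.Nat using (ℕ; _+_; _≤_; ∣_-_∣)
open import Data.Product using (∃; ∃-syntax; _×_; _,_; proj₁; proj₂)
open import Data.Sum using (_⊎_)
open import Data.Unit using (⊤)
open import Function using (_∘_; _⇔_; Equivalence; Bijective)
open import Level using (0ℓ)
open import Relation.Binary.PropositionalEquality
  using (_≡_; _≢_; _≗_; refl; sym; subst)
open import Relation.Nullary using (¬_)
open import Relation.Unary using (Pred)

-- A finite simple graph whose vertices form a subset of the ambient set
-- Fin n, so that several graphs can share vertices and be united.
record Graph (n : ℕ) : Set where
  field
    V         : Subset n
    neighbors : Fin n → Subset n
    symmetric : ∀ {x y} → y ∈ neighbors x → x ∈ neighbors y
    loopless  : ∀ {x} → x ∉ neighbors x
    supported : ∀ {x y} → y ∈ neighbors x → y ∈ V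

open Graph public using (V; neighbors)

Adj : ∀ {n} → Graph n → Fin n → Fin n → Set
Adj G x y = y ∈ neighbors G x

Vertex : ∀ {n} → Graph n → Set
Vertex G = ∃ λ x → x ∈ V G

pair : ∀ {n} → Fin n → Fin n → Subset n
pair x y = ⁅ x ⁆ ∪ ⁅ y ⁆

record IsUnion {n k} (G : Graph n) (Gs : Fin k → Graph n) : Set where
  field
    vertices : ∀ x → x ∈ V G ⇔ (∃[ i ] x ∈ V (Gs i))
    edges    : ∀ x y → Adj G x y ⇔ (∃[ i ] Adj (Gs i) x y)

-- The number of parts is 2 + m, so that it is at least two.
record SerialComposition {n m} (G : Graph n) (s t : Fin n)
    (Gs : Fin (2 + m) → Graph n) (ss ts : Fin (2 + m) → Fin n) : Set where
  field
    first       : ss zero ≡ s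
    last        : ts (fromℕ (1 + m)) ≡ t
    consecutive : ∀ (i : Fin (1 + m)) → ts (inject₁ i) ≡ ss (suc i)
    meet        : ∀ (i : Fin (1 + m)) →
                  V (Gs (inject₁ i)) ∩ V (Gs (suc i)) ≡ ⁅ ss (suc i) ⁆
    disjoint    : ∀ i j → 2 ≤ ∣ toℕ i - toℕ j ∣ → V (Gs i) ∩ V (Gs j) ≡ ∅
    union       : IsUnion G Gs

record ParallelComposition {n m} (G : Graph n) (s t : Fin n)
    (Gs : Fin (2 + m) → Graph n) : Set where
  field
    meet  : ∀ i j → i ≢ j → V (Gs i) ∩ V (Gs j) ≡ pair s t
    union : IsUnion G Gs

-- s ≢ t is only required of a single edge; the other two clauses inherit it.
data OrientedSP {n} : Graph n → Fin n → Fin n → Set where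
  edge : ∀ {G s t} → s ≢ t → V G ≡ pair s t → Adj G s t → OrientedSP G s t
  serial : ∀ {m G s t}
    (Gs : Fin (2 + m) → Graph n) (ss ts : Fin (2 + m) → Fin n) →
    (∀ i → OrientedSP (Gs i) (ss i) (ts i)) →
    SerialComposition G s t Gs ss ts → OrientedSP G s t
  parallel : ∀ {m G s t}
    (Gs : Fin (2 + m) → Graph n) →
    (∀ i → OrientedSP (Gs i) s t) →
    ParallelComposition G s t Gs → OrientedSP G s t

-- Whether a graph is a parallel superedge is read off from its recursive
-- construction.  Asking instead whether some parallel composition yields it
-- would make every single edge parallel: as graphs are simple, an edge st is
-- the union of two copies of itself, which meet in {s , t}.
IsParallel : ∀ {n} {G : Graph n} {s t} → OrientedSP G s t → Set
IsParallel (edge _ _ _)       = ⊥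
IsParallel (serial _ _ _ _ _) = ⊥
IsParallel (parallel _ _ _)   = ⊤

NonParallel : ∀ {n} {G : Graph n} {s t} → OrientedSP G s t → Set
NonParallel P = ¬ IsParallel P

source∈ : ∀ {n} {G : Graph n} {s t} → OrientedSP G s t → s ∈ V G
source∈ {s = s} {t} (edge _ eq _) =
  subst (s ∈_) (sym eq) (p⊆p∪q ⁅ t ⁆ (x∈⁅x⁆ s))
source∈ (serial Gs ss ts Ps c) =
  Equivalence.from (IsUnion.vertices union _)
    (zero , subst (_∈ V (Gs zero)) first (source∈ (Ps zero)))
  where open SerialComposition c
source∈ (parallel Gs Ps c) =
  Equivalence.from (IsUnion.vertices union _) (zero , source∈ (Ps zero))
  where open ParallelComposition c

target∈ : ∀ {n} {G : Graph n} {s t} → OrientedSP G s t → t ∈ V G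
target∈ {s = s} {t} (edge _ eq _) =
  subst (t ∈_) (sym eq) (q⊆p∪q ⁅ s ⁆ ⁅ t ⁆ (x∈⁅x⁆ t))
target∈ (serial {m} Gs ss ts Ps c) =
  Equivalence.from (IsUnion.vertices union _)
    (fromℕ (1 + m) ,
     subst (_∈ V (Gs (fromℕ (1 + m)))) last (target∈ (Ps (fromℕ (1 + m)))))
  where open SerialComposition c
target∈ (parallel Gs Ps c) =
  Equivalence.from (IsUnion.vertices union _) (zero , target∈ (Ps zero))
  where open ParallelComposition c

source target : ∀ {n} {G : Graph n} {s t} → OrientedSP G s t → Vertex G
source P = _ , source∈ P
target P = _ , target∈ P

IsIsomorphism : ∀ {n} (G H : Graph n) → (Vertex G → Vertex H) → Set
IsIsomorphism G H f =
  Bijective _≡_ _≡_ f ×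
  (∀ u v → Adj G (proj₁ u) (proj₁ v) ⇔ Adj H (proj₁ (f u)) (proj₁ (f v)))

IsAutomorphism : ∀ {n} (G : Graph n) → Pred (Vertex G → Vertex G) 0ℓ
IsAutomorphism G = IsIsomorphism G G

AutOr : ∀ {n} {G : Graph n} {s t} →
        OrientedSP G s t → Pred (Vertex G → Vertex G) 0ℓ
AutOr {G = G} P σ =
  IsAutomorphism G σ × σ (source P) ≡ source P × σ (target P) ≡ target P

AutSemi : ∀ {n} {G : Graph n} {s t} →
          OrientedSP G s t → Pred (Vertex G → Vertex G) 0ℓ
AutSemi {G = G} {s} {t} P σ =
  IsAutomorphism G σ ×
  pair (proj₁ (σ (source P))) (proj₁ (σ (target P))) ≡ pair s t

record Reversal {n k} {s t : Fin n} {Gs : Fin k → Graph n}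
    (Ps : ∀ i → OrientedSP (Gs i) s t) : Set where
  field
    τ   : Permutation′ k
    r   : ∀ i → Vertex (Gs i) → Vertex (Gs (τ ⟨$⟩ʳ i))
    iso : ∀ i → IsIsomorphism (Gs i) (Gs (τ ⟨$⟩ʳ i)) (r i)
    s↦t : ∀ i → r i (source (Ps i)) ≡ target (Ps (τ ⟨$⟩ʳ i))
    t↦s : ∀ i → r i (target (Ps i)) ≡ source (Ps (τ ⟨$⟩ʳ i))

RestrictsTo : ∀ {n k} {s t : Fin n} {G : Graph n} {Gs : Fin k → Graph n}
              {Ps : ∀ i → OrientedSP (Gs i) s t} →
              (Vertex G → Vertex G) → Reversal Ps → Set
RestrictsTo {Gs = Gs} f ρ =
  ∀ i x x∈G (x∈Gᵢ : x ∈ V (Gs i)) →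
  proj₁ (f (x , x∈G)) ≡ proj₁ (Reversal.r ρ i (x , x∈Gᵢ))

-- The set { σ , r σ : σ ∈ A }, with maps identified when pointwise equal.
WithTranslate : ∀ {X : Set} → (X → X) → Pred (X → X) 0ℓ → Pred (X → X) 0ℓ
WithTranslate r A f = ∃[ σ ] A σ × (f ≗ σ ⊎ f ≗ r ∘ σ)

{-# OPTIONS --safe #-}
module Submission where

-- Deleting both terminals from a serial superedge leaves a nonempty connected
-- graph (consecutive cut vertices stay linked by the part between them), and a serial superedge
-- never contains the edge st.  So the parts of a parallel superedge with
-- non-parallel parts are recovered from G as the components of G − {s,t},
-- together with the edge st.  An automorphism exchanging s and t permutes these
-- components and hence yields a reversal; conversely a reversal glues to such an
-- automorphism r, and r⁻¹ turns any other one into an element of Aut_or.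

open import Defs
open import Data.Empty using (⊥-elim)
open import Data.Fin using (Fin; zero; suc; toℕ; fromℕ; inject₁; _≟_)
open import Data.Fin.Induction using (<-weakInduction)
open import Data.Fin.Permutation using (permutation; _⟨$⟩ʳ_; _⟨$⟩ˡ_; inverseˡ; inverseʳ)
open import Data.Fin.Properties using (toℕ-inject₁; toℕ-fromℕ; toℕ<n)
open import Data.Fin.Relation.Unary.Top using (view; ‵fromℕ; ‵inject₁)
open import Data.Fin.Subset using (Subset; _∈_; _∉_; ⁅_⁆)
open import Data.Fin.Subset.Properties
  using (x∈⁅x⁆; x∈⁅y⁆⇒x≡y; x∈p∪q⁻; p⊆p∪q; q⊆p∪q; x∈p∩q⁺; ∉⊥; _∈?_; ∪-comm)
open import Data.Nat using (ℕ; suc; _+_; _≤_; _<_; s≤s; z≤n; ∣_-_∣)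
open import Data.Product using (∃; _×_; _,_; proj₁; proj₂; ∃-syntax)
open import Data.Sum using (_⊎_; inj₁; inj₂; [_,_]′)
open import Data.Vec.Properties.WithK using ([]=-irrelevant)
open import Function.Construct.Composition using (bijective)
open import Function using (_∘_; _⇔_; Equivalence; mk⇔; id; case_of_)
open import Level using (0ℓ)
open import Relation.Binary.PropositionalEquality
  using (_≡_; _≢_; _≗_; refl; sym; trans; cong; cong₂; subst; subst₂)
open import Relation.Nullary using (¬_; Dec; yes; no; contradiction)
open import Relation.Nullary.Decidable using (_⊎-dec_)
open import Relation.Unary using (Pred; _≐_)

private
  variable
    n : ℕ
    G H : Graph n
    s t : Fin n

-- Terminals and connectivity away from a set of vertices.

Terminal : Fin n → Fin n → Pred (Fin n) 0ℓ
Terminal s t x = x ≡ s ⊎ x ≡ t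

terminal? : (s t x : Fin n) → Dec (Terminal s t x)
terminal? s t x = (x ≟ s) ⊎-dec (x ≟ t)

∈pair⇒terminal : {x : Fin n} → x ∈ pair s t → Terminal s t x
∈pair⇒terminal x∈ =
  [ inj₁ ∘ x∈⁅y⁆⇒x≡y _ , inj₂ ∘ x∈⁅y⁆⇒x≡y _ ]′ (x∈p∪q⁻ _ _ x∈)

pairˡ : (s t : Fin n) → s ∈ pair s t
pairˡ s t = p⊆p∪q ⁅ t ⁆ (x∈⁅x⁆ s)

pairʳ : (s t : Fin n) → t ∈ pair s t
pairʳ s t = q⊆p∪q ⁅ s ⁆ ⁅ t ⁆ (x∈⁅x⁆ t)

adj⇒∈ˡ : (G : Graph n) {x y : Fin n} → Adj G x y → x ∈ V G
adj⇒∈ˡ G = Graph.supported G ∘ Graph.symmetric G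

adj⇒∈ʳ : (G : Graph n) {x y : Fin n} → Adj G x y → y ∈ V G
adj⇒∈ʳ G = Graph.supported G

adj⇒≢ : (G : Graph n) {x y : Fin n} → Adj G x y → x ≢ y
adj⇒≢ G a refl = Graph.loopless G a

-- H − F is connected: every colouring constant along its edges is constant.
ConnectedOff : Graph n → Pred (Fin n) 0ℓ → Set₁
ConnectedOff H F = ∀ {A : Set} (g : Fin _ → A) →
  (∀ {x y} → Adj H x y → ¬ F x → ¬ F y → g x ≡ g y) →
  ∀ {x y} → x ∈ V H → y ∈ V H → ¬ F x → ¬ F y → g x ≡ g y

-- The condition under which connectivity survives the recursion: a parallel superedge may fall
-- apart once both terminals go, but not when at most one does. It is only an upper bound: `F` may
-- miss `p`, and may hold outside `H`, so the same `F` can be passed down to every part.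
MeetsOneTerminal : Graph n → Fin n → Fin n → Pred (Fin n) 0ℓ → Set
MeetsOneTerminal H s t F =
  ∃[ p ] Terminal s t p × (∀ {z} → z ∈ V H → F z → z ≡ p)

∣m-1+n∣≥2 : ∀ {m n} → m < n → 2 ≤ ∣ m - suc n ∣
∣m-1+n∣≥2 {ℕ.zero} {suc n} _ = s≤s (s≤s z≤n)
∣m-1+n∣≥2 {suc m} {suc n} (s≤s m<n) = ∣m-1+n∣≥2 m<n

-- Serial superedges and their cut vertices.

module Serial {n m} {H : Graph n} {s t} {Hs : Fin (2 + m) → Graph n}
  {ss ts} (Ps : ∀ i → OrientedSP (Hs i) (ss i) (ts i))
  (s≢t : ∀ i → ss i ≢ ts i) (c : SerialComposition H s t Hs ss ts) where

  open SerialComposition c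

  s∈first : s ∈ V (Hs zero)
  s∈first = subst (_∈ V (Hs zero)) first (source∈ (Ps zero))

  t∈last : t ∈ V (Hs (fromℕ (1 + m)))
  t∈last = subst (_∈ V (Hs (fromℕ (1 + m)))) last (target∈ (Ps (fromℕ (1 + m))))

  meet∈ : ∀ i {x} → x ∈ V (Hs (inject₁ i)) → x ∈ V (Hs (suc i)) → x ≡ ss (suc i)
  meet∈ i x∈ x∈′ = x∈⁅y⁆⇒x≡y _ (subst (_ ∈_) (meet i) (x∈p∩q⁺ (x∈ , x∈′)))

  disjoint∉ : ∀ i j → 2 ≤ ∣ toℕ i - toℕ j ∣ → ∀ {x} → x ∈ V (Hs i) → x ∉ V (Hs j)
  disjoint∉ i j d x∈ x∈′ = ∉⊥ (subst (_ ∈_) (disjoint i j d) (x∈p∩q⁺ (x∈ , x∈′)))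

  -- The second part meets the first only in the target of the first, which differs from its source
  -- `s`; all later parts are disjoint from the first.
  source∉ : ∀ i → s ∉ V (Hs (suc i))
  source∉ zero s∈ = s≢t zero
    (trans first (trans (meet∈ zero s∈first s∈) (sym (consecutive zero))))
  source∉ (suc i) s∈ = disjoint∉ zero (suc (suc i)) (s≤s (s≤s z≤n)) s∈first s∈

  -- The mirror image of `source∉`: `view i` tells whether part `inject₁ i` is the penultimate one,
  -- meeting the last part in a cut vertex, or an earlier one, disjoint from it.
  target∉ : ∀ i → t ∉ V (Hs (inject₁ i))
  target∉ i t∈ with view i
  ... | ‵fromℕ = s≢t (suc (fromℕ m)) (trans (sym (meet∈ (fromℕ m) t∈ t∈last)) (sym last))
  ... | ‵inject₁ j = disjoint∉ (inject₁ (inject₁ j)) (fromℕ (1 + m)) gap t∈ t∈last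
    where
    gap : 2 ≤ ∣ toℕ (inject₁ (inject₁ j)) - suc (toℕ (fromℕ m)) ∣
    gap rewrite toℕ-inject₁ (inject₁ j) | toℕ-inject₁ j | toℕ-fromℕ m =
      ∣m-1+n∣≥2 (toℕ<n j)

  target-of-part : ∀ i → t ∈ V (Hs i) → t ≡ ts i
  target-of-part i t∈ with view i
  ... | ‵fromℕ = sym last
  ... | ‵inject₁ j = ⊥-elim (target∉ j t∈)

  terminals-distinct : s ≢ t
  terminals-distinct refl = target∉ zero s∈first

  -- An edge lies inside a single part, but the first part misses `t` and all others miss `s`.
  terminals-nonadjacent : ¬ Adj H s t
  terminals-nonadjacent st with Equivalence.to (IsUnion.edges union _ _) st
  ... | zero , a = target∉ zero (adj⇒∈ʳ (Hs zero) a)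
  ... | suc i , a = source∉ i (adj⇒∈ˡ (Hs (suc i)) a)

  cut : Fin (1 + m) → Fin n
  cut i = ss (suc i)

  cut∈ˡ : ∀ i → cut i ∈ V (Hs (inject₁ i))
  cut∈ˡ i = subst (_∈ V (Hs (inject₁ i))) (consecutive i) (target∈ (Ps (inject₁ i)))

  cut∈ʳ : ∀ i → cut i ∈ V (Hs (suc i))
  cut∈ʳ i = source∈ (Ps (suc i))

  cut-interior : ∀ i → ¬ Terminal s t (cut i)
  cut-interior i (inj₁ eq) = source∉ i (subst (_∈ V (Hs (suc i))) eq (cut∈ʳ i))
  cut-interior i (inj₂ eq) = target∉ i (subst (_∈ V (Hs (inject₁ i))) eq (cut∈ˡ i))

  part⊆ : ∀ i {x} → x ∈ V (Hs i) → x ∈ V H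
  part⊆ i x∈ = Equivalence.from (IsUnion.vertices union _) (i , x∈)

  module _ {F : Pred (Fin n) 0ℓ}
    (F⊆terminal : ∀ {z} → z ∈ V H → F z → Terminal s t z)
    (part-connected : ∀ i → MeetsOneTerminal (Hs i) (ss i) (ts i) F →
                      ConnectedOff (Hs i) F) where

    -- Even if `F` contains both `s` and `t`, the first part can only lose `s` and the last only
    -- `t`. Intermediate parts lose nothing, so naming their target is an arbitrary choice.
    part-meets : ∀ i → MeetsOneTerminal (Hs i) (ss i) (ts i) F
    part-meets zero = ss zero , inj₁ refl , λ z∈ Fz →
      case F⊆terminal (part⊆ zero z∈) Fz of λ where
        (inj₁ z≡s) → trans z≡s (sym first)
        (inj₂ refl) → ⊥-elim (target∉ zero z∈)
    part-meets (suc i) = ts (suc i) , inj₂ refl , λ z∈ Fz →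
      case F⊆terminal (part⊆ (suc i) z∈) Fz of λ where
        (inj₁ refl) → ⊥-elim (source∉ i z∈)
        (inj₂ refl) → target-of-part (suc i) z∈

    cut∉F : ∀ i → ¬ F (cut i)
    cut∉F i = cut-interior i ∘ F⊆terminal (part⊆ (suc i) (cut∈ʳ i))

    -- No cut vertex is in `F`, so each vertex is linked within its part to a cut vertex, and the
    -- cut vertices are linked along the chain. This serves both the deletion of at most one
    -- terminal in `connected` and that of both terminals in `shape`.
    serial-connected : ConnectedOff H F
    serial-connected {A} g closed x∈ y∈ x∉F y∉F =
      trans (to-cut x∈ x∉F) (sym (to-cut y∈ y∉F))
      where
      part : ∀ i {x y} → x ∈ V (Hs i) → y ∈ V (Hs i) → ¬ F x → ¬ F y → g x ≡ g y
      part i = part-connected i (part-meets i) g λ a →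
        closed (Equivalence.from (IsUnion.edges union _ _) (i , a))

      cuts : ∀ i → g (cut i) ≡ g (cut zero)
      cuts = <-weakInduction _ refl λ i eq →
        -- This part, whose index is also `inject₁ (suc i)`, runs from `cut (inject₁ i)` to
        -- `cut (suc i)`.
        trans (part (suc (inject₁ i)) (cut∈ˡ (suc i)) (cut∈ʳ (inject₁ i))
                    (cut∉F (suc i)) (cut∉F (inject₁ i)))
              eq

      to-cut : ∀ {x} → x ∈ V H → ¬ F x → g x ≡ g (cut zero)
      to-cut x∈ x∉F with Equivalence.to (IsUnion.vertices union _) x∈
      ... | zero , x∈₀ = part zero x∈₀ (cut∈ˡ zero) x∉F (cut∉F zero)
      ... | suc i , x∈ᵢ =
        trans (part (suc i) x∈ᵢ (cut∈ʳ i) x∉F (cut∉F i)) (cuts i)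

-- Connectivity of series-parallel graphs and the shapes of non-parallel ones.

terminals-distinct : OrientedSP H s t → s ≢ t
terminals-distinct (edge s≢t _ _) = s≢t
terminals-distinct (serial _ _ _ Ps c) =
  Serial.terminals-distinct Ps (λ i → terminals-distinct (Ps i)) c
terminals-distinct (parallel _ Ps _) = terminals-distinct (Ps zero)

other-terminal : {p : Fin n} → s ≢ t → Terminal s t p → ∃[ q ] Terminal s t q × q ≢ p
other-terminal s≢t (inj₁ refl) = _ , inj₂ refl , s≢t ∘ sym
other-terminal s≢t (inj₂ refl) = _ , inj₁ refl , s≢t

terminal∈ : OrientedSP H s t → ∀ {x} → Terminal s t x → x ∈ V H
terminal∈ P (inj₁ refl) = source∈ P
terminal∈ P (inj₂ refl) = target∈ P

terminals-adjacent : (G : Graph n) → Adj G s t →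
  ∀ {x y} → Terminal s t x → Terminal s t y → x ≢ y → Adj G x y
terminals-adjacent G st (inj₁ refl) (inj₁ refl) x≢y = contradiction refl x≢y
terminals-adjacent G st (inj₁ refl) (inj₂ refl) x≢y = st
terminals-adjacent G st (inj₂ refl) (inj₁ refl) x≢y = Graph.symmetric G st
terminals-adjacent G st (inj₂ refl) (inj₂ refl) x≢y = contradiction refl x≢y

adjacent-terminals : (G : Graph n) {x y : Fin n} → Terminal s t x → Terminal s t y →
  Adj G x y → Adj G s t
adjacent-terminals G (inj₁ refl) (inj₁ refl) a = contradiction a (Graph.loopless G)
adjacent-terminals G (inj₁ refl) (inj₂ refl) a = a
adjacent-terminals G (inj₂ refl) (inj₁ refl) a = Graph.symmetric G a
adjacent-terminals G (inj₂ refl) (inj₂ refl) a = contradiction a (Graph.loopless G)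

-- Induction on the construction. In the parallel case the terminal `q` other than `p` survives the
-- deletion and lies in every part, so each vertex is linked to `q` inside its own part.
connected : OrientedSP H s t → ∀ {F} → MeetsOneTerminal H s t F → ConnectedOff H F
connected {H = H} (edge s≢t eq st) _ g closed {x} {y} x∈ y∈ x∉F y∉F with x ≟ y
... | yes x≡y = cong g x≡y
... | no  x≢y = closed
  (terminals-adjacent H st (∈pair⇒terminal (subst (_ ∈_) eq x∈))
                           (∈pair⇒terminal (subst (_ ∈_) eq y∈)) x≢y)
  x∉F y∉F
connected (serial _ _ _ Ps c) (p , Tp , F⊆p) =
  Serial.serial-connected Ps (λ i → terminals-distinct (Ps i)) c
    (λ z∈ Fz → subst (Terminal _ _) (sym (F⊆p z∈ Fz)) Tp)
    (λ i → connected (Ps i))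
connected {H = H} P@(parallel Hs Ps c) {F} (p , Tp , F⊆p) g closed x∈ y∈ x∉F y∉F
  with q , Tq , q≢p ← other-terminal (terminals-distinct P) Tp =
  trans (to-q x∈ x∉F) (sym (to-q y∈ y∉F))
  where
  open ParallelComposition c
  part⊆ : ∀ i {x} → x ∈ V (Hs i) → x ∈ V H
  part⊆ i x∈ = Equivalence.from (IsUnion.vertices union _) (i , x∈)

  to-q : ∀ {x} → x ∈ V H → ¬ F x → g x ≡ g q
  to-q x∈ x∉F with i , x∈ᵢ ← Equivalence.to (IsUnion.vertices union _) x∈ =
    connected (Ps i) (p , Tp , F⊆p ∘ part⊆ i) g
      (λ a → closed (Equivalence.from (IsUnion.edges union _ _) (i , a)))
      x∈ᵢ (terminal∈ (Ps i) Tq) x∉F (q≢p ∘ F⊆p (terminal∈ P Tq))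

-- What the recovery of the parts from the union relies on. The vertex `w` is a representative of
-- the interior, from which the image of the whole part will be read off.
data Shape (H : Graph n) (s t : Fin n) : Set₁ where
  bare-edge : (∀ {x} → x ∈ V H → Terminal s t x) → Adj H s t → Shape H s t
  proper    : ∀ w → w ∈ V H → ¬ Terminal s t w → ¬ Adj H s t →
              ConnectedOff H (Terminal s t) → Shape H s t

shape : (P : OrientedSP H s t) → NonParallel P → Shape H s t
shape (edge _ eq st) _ = bare-edge (λ x∈ → ∈pair⇒terminal (subst (_ ∈_) eq x∈)) st
shape (serial _ _ _ Ps c) _ =
  proper (cut zero) (part⊆ (suc zero) (cut∈ʳ zero)) (cut-interior zero)
    -- Here `F` is all of `Terminal s t`: both terminals are deleted at once.
    terminals-nonadjacent (serial-connected (λ _ → id) (λ i → connected (Ps i)))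
  where open Serial Ps (λ i → terminals-distinct (Ps i)) c hiding (terminals-distinct)
shape (parallel _ _ _) np = ⊥-elim (np _)

-- Isomorphisms between graphs on vertex subsets.

vertex-≡ : {p : Subset n} {u v : ∃ (_∈ p)} → proj₁ u ≡ proj₁ v → u ≡ v
vertex-≡ {u = x , x∈} {.x , x∈′} refl = cong (x ,_) ([]=-irrelevant x∈ x∈′)

iso-∘ : {K : Graph n} {f : Vertex H → Vertex K} {g : Vertex G → Vertex H} →
  IsIsomorphism H K f → IsIsomorphism G H g → IsIsomorphism G K (f ∘ g)
iso-∘ {f = f} {g} (f-bij , f-adj) (g-bij , g-adj) =
  bijective _≡_ _≡_ _≡_ g-bij f-bij ,
  λ u v → mk⇔ (Equivalence.to (f-adj (g u) (g v)) ∘ Equivalence.to (g-adj u v))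
              (Equivalence.from (g-adj u v) ∘ Equivalence.from (f-adj (g u) (g v)))

iso-resp-≗ : {f g : Vertex G → Vertex H} → f ≗ g →
  IsIsomorphism G H f → IsIsomorphism G H g
iso-resp-≗ {H = H} f≗g ((inj , surj) , adj) =
  ((λ {u} {v} eq → inj (trans (f≗g u) (trans eq (sym (f≗g v))))) ,
   (λ y → proj₁ (surj y) , λ {z} eq → trans (sym (f≗g z)) (proj₂ (surj y) eq))) ,
  λ u v → subst₂ (λ u′ v′ → _ ⇔ Adj H (proj₁ u′) (proj₁ v′)) (f≗g u) (f≗g v) (adj u v)

iso-inverse : {f : Vertex G → Vertex H} → IsIsomorphism G H f →
  ∃[ g ] IsIsomorphism H G g × (∀ v → f (g v) ≡ v) × (∀ v → g (f v) ≡ v)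
iso-inverse {G = G} {H} {f} ((inj , surj) , adj) =
  g , ((g-inj , λ v → f v , λ { refl → gf v }) ,
       λ u v → mk⇔
         (Equivalence.from (adj (g u) (g v)) ∘
          subst₂ (λ u′ v′ → Adj H (proj₁ u′) (proj₁ v′)) (sym (fg u)) (sym (fg v)))
         (subst₂ (λ u′ v′ → Adj H (proj₁ u′) (proj₁ v′)) (fg u) (fg v) ∘
          Equivalence.to (adj (g u) (g v)))) ,
  fg , gf
  where
  g : Vertex H → Vertex G
  g v = proj₁ (surj v)

  fg : ∀ v → f (g v) ≡ v
  fg v = proj₂ (surj v) refl

  gf : ∀ v → g (f v) ≡ v
  gf v = inj (fg (f v))

  g-inj : ∀ {u v} → g u ≡ g v → u ≡ v
  g-inj {u} {v} eq = trans (sym (fg u)) (trans (cong f eq) (fg v))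

-- Automorphisms preserving the terminal pair: the subgroup `AutOr` and its coset of exchanging
-- maps.

AutSwap : OrientedSP G s t → Pred (Vertex G → Vertex G) 0ℓ
AutSwap {G = G} P f =
  IsAutomorphism G f × f (source P) ≡ target P × f (target P) ≡ source P

module _ {n} {G : Graph n} {s t : Fin n} (P : OrientedSP G s t) where

  -- Equality of unordered pairs only places each image in `pair s t`; injectivity of `f` and
  -- `s ≢ t` exclude the two cases where the images coincide.
  semi⇒or⊎swap : ∀ {f} → AutSemi P f → AutOr P f ⊎ AutSwap P f
  semi⇒or⊎swap {f} (aut@((inj , _) , _) , eq)
    with ∈pair⇒terminal (subst (proj₁ (f (source P)) ∈_) eq (pairˡ _ _))
       | ∈pair⇒terminal (subst (proj₁ (f (target P)) ∈_) eq (pairʳ _ _))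
  ... | inj₁ s↦s | inj₂ t↦t = inj₁ (aut , vertex-≡ s↦s , vertex-≡ t↦t)
  ... | inj₂ s↦t | inj₁ t↦s = inj₂ (aut , vertex-≡ s↦t , vertex-≡ t↦s)
  ... | inj₁ s↦s | inj₁ t↦s =
    contradiction (cong proj₁ (inj (vertex-≡ (trans s↦s (sym t↦s))))) (terminals-distinct P)
  ... | inj₂ s↦t | inj₂ t↦t =
    contradiction (cong proj₁ (inj (vertex-≡ (trans s↦t (sym t↦t))))) (terminals-distinct P)

  or⇒semi : ∀ {f} → AutOr P f → AutSemi P f
  or⇒semi (aut , s↦s , t↦t) = aut , cong₂ pair (cong proj₁ s↦s) (cong proj₁ t↦t)

  swap⇒semi : ∀ {f} → AutSwap P f → AutSemi P f
  swap⇒semi (aut , s↦t , t↦s) =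
    aut , trans (cong₂ pair (cong proj₁ s↦t) (cong proj₁ t↦s)) (∪-comm ⁅ t ⁆ ⁅ s ⁆)

  semi-resp-≗ : ∀ {f g} → f ≗ g → AutSemi P f → AutSemi P g
  semi-resp-≗ f≗g (aut , eq) =
    iso-resp-≗ {G = G} {H = G} f≗g aut ,
    trans (cong₂ pair (cong proj₁ (sym (f≗g _))) (cong proj₁ (sym (f≗g _)))) eq

  swap-inverse : ∀ {f} → AutSwap P f →
    ∃[ g ] AutSwap P g × (∀ v → f (g v) ≡ v) × (∀ v → g (f v) ≡ v)
  swap-inverse (aut , s↦t , t↦s) with g , g-aut , fg , gf ← iso-inverse {G = G} {G} aut =
    g , (g-aut , trans (cong g (sym t↦s)) (gf _) , trans (cong g (sym s↦t)) (gf _)) , fg , gf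

  -- The coset argument: if `f` exchanges the terminals, then with `g` inverse to `r` the map
  -- `g ∘ f` fixes both, and `f` is `r ∘ (g ∘ f)`.
  semi≐or∪swap∘or : ∀ {r} → AutSwap P r → AutSemi P ≐ WithTranslate r (AutOr P)
  semi≐or∪swap∘or {r} r-swap@(r-aut , s↦t , t↦s) = ⊆ , ⊇
    where
    ⊆ : ∀ {f} → AutSemi P f → WithTranslate r (AutOr P) f
    ⊆ {f} f-semi with semi⇒or⊎swap f-semi
    ... | inj₁ f-or = f , f-or , inj₁ λ _ → refl
    ... | inj₂ (f-aut , fs , ft) with g , (g-aut , gs , gt) , rg , _ ← swap-inverse r-swap =
      g ∘ f ,
      (iso-∘ {H = G} {G = G} {K = G} g-aut f-aut ,
       trans (cong g fs) gt , trans (cong g ft) gs) ,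
      inj₂ (λ v → sym (rg (f v)))

    ⊇ : ∀ {f} → WithTranslate r (AutOr P) f → AutSemi P f
    ⊇ (σ , σ-or , inj₁ f≗σ) = semi-resp-≗ (sym ∘ f≗σ) (or⇒semi σ-or)
    ⊇ (σ , (σ-aut , σs , σt) , inj₂ f≗rσ) = semi-resp-≗ (sym ∘ f≗rσ)
      (swap⇒semi (iso-∘ {H = G} {G = G} {K = G} r-aut σ-aut ,
                  trans (cong r σs) s↦t , trans (cong r σt) t↦s))

-- Parallel superedges and the overlap of their parts.

module Parallel {n m} {G : Graph n} {s t} {Gs : Fin (2 + m) → Graph n}
  (Ps : ∀ i → OrientedSP (Gs i) s t) (c : ParallelComposition G s t Gs) where

  open ParallelComposition c

  P : OrientedSP G s t
  P = parallel Gs Ps c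

  part-of : ∀ {x} → x ∈ V G → ∃[ i ] x ∈ V (Gs i)
  part-of = Equivalence.to (IsUnion.vertices union _)

  part⊆ : ∀ i {x} → x ∈ V (Gs i) → x ∈ V G
  part⊆ i x∈ = Equivalence.from (IsUnion.vertices union _) (i , x∈)

  part-adj : ∀ i {x y} → Adj (Gs i) x y → Adj G x y
  part-adj i a = Equivalence.from (IsUnion.edges union _ _) (i , a)

  include : ∀ i → Vertex (Gs i) → Vertex G
  include i (x , x∈) = x , part⊆ i x∈

  shared-terminal : ∀ {i j x} → i ≢ j → x ∈ V (Gs i) → x ∈ V (Gs j) → Terminal s t x
  shared-terminal {i} {j} i≢j x∈ᵢ x∈ⱼ =
    ∈pair⇒terminal (subst (_ ∈_) (meet i j i≢j) (x∈p∩q⁺ (x∈ᵢ , x∈ⱼ)))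

  part-unique : ∀ {i j x} → ¬ Terminal s t x → x ∈ V (Gs i) → x ∈ V (Gs j) → i ≡ j
  part-unique {i} {j} interior x∈ᵢ x∈ⱼ with i ≟ j
  ... | yes i≡j = i≡j
  ... | no  i≢j = contradiction (shared-terminal i≢j x∈ᵢ x∈ⱼ) interior

  -- From a reversal to an automorphism exchanging the terminals.

  module FromReversal (ρ : Reversal Ps) where
    open Reversal ρ renaming (τ to π; r to rᵢ)

    τ : Fin (2 + m) → Fin (2 + m)
    τ = π ⟨$⟩ʳ_

    τ-injective : ∀ {i j} → τ i ≡ τ j → i ≡ j
    τ-injective eq =
      trans (sym (inverseˡ π)) (trans (cong (π ⟨$⟩ˡ_) eq) (inverseˡ π))

    rᵢ-source : ∀ i (s∈ : s ∈ V (Gs i)) → proj₁ (rᵢ i (s , s∈)) ≡ t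
    rᵢ-source i s∈ = cong proj₁ (trans (cong (rᵢ i) (vertex-≡ refl)) (s↦t i))

    rᵢ-target : ∀ i (t∈ : t ∈ V (Gs i)) → proj₁ (rᵢ i (t , t∈)) ≡ s
    rᵢ-target i t∈ = cong proj₁ (trans (cong (rᵢ i) (vertex-≡ refl)) (t↦s i))

    -- Distinct parts share only the terminals, and there all the maps take the same values.
    rᵢ-agree : ∀ i j {x} (x∈ᵢ : x ∈ V (Gs i)) (x∈ⱼ : x ∈ V (Gs j)) →
      proj₁ (rᵢ i (x , x∈ᵢ)) ≡ proj₁ (rᵢ j (x , x∈ⱼ))
    rᵢ-agree i j x∈ᵢ x∈ⱼ with i ≟ j
    ... | yes refl = cong (proj₁ ∘ rᵢ i) (vertex-≡ refl)
    ... | no i≢j with shared-terminal i≢j x∈ᵢ x∈ⱼ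
    ...   | inj₁ refl = trans (rᵢ-source i x∈ᵢ) (sym (rᵢ-source j x∈ⱼ))
    ...   | inj₂ refl = trans (rᵢ-target i x∈ᵢ) (sym (rᵢ-target j x∈ⱼ))

    glue : ∃[ r ] RestrictsTo {G = G} r ρ
    glue = (λ (x , x∈) → let i , x∈ᵢ = part-of x∈ in include (τ i) (rᵢ i (x , x∈ᵢ))) ,
           -- The part chosen by `part-of` need not be `i`, but the choice does not affect the
           -- value.
           (λ i x x∈ x∈ᵢ → rᵢ-agree (proj₁ (part-of x∈)) i _ x∈ᵢ)

    module _ (r : Vertex G → Vertex G) (restricts : RestrictsTo {G = G} r ρ) where

      r-include : ∀ i v → r (include i v) ≡ include (τ i) (rᵢ i v)
      r-include i (x , x∈) = vertex-≡ (restricts i x (part⊆ i x∈) x∈)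

      in-part : ∀ v → ∃[ i ] ∃[ u ] v ≡ include i u
      in-part (x , x∈) with i , x∈ᵢ ← part-of x∈ = i , (x , x∈ᵢ) , vertex-≡ refl

      r-source : r (source P) ≡ target P
      r-source = vertex-≡ (trans (restricts zero s _ (source∈ (Ps zero))) (rᵢ-source zero _))

      r-target : r (target P) ≡ source P
      r-target = vertex-≡ (trans (restricts zero t _ (target∈ (Ps zero))) (rᵢ-target zero _))

      rᵢ-injective : ∀ i {u v} → proj₁ (rᵢ i u) ≡ proj₁ (rᵢ i v) → u ≡ v
      rᵢ-injective i eq = proj₁ (proj₁ (iso i)) (vertex-≡ eq)

      source-preimage : ∀ i u → proj₁ (rᵢ i u) ≡ s → proj₁ u ≡ t
      source-preimage i u eq =
        cong proj₁ (rᵢ-injective i (trans eq (sym (rᵢ-target i (target∈ (Ps i))))))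

      target-preimage : ∀ i u → proj₁ (rᵢ i u) ≡ t → proj₁ u ≡ s
      target-preimage i u eq =
        cong proj₁ (rᵢ-injective i (trans eq (sym (rᵢ-source i (source∈ (Ps i))))))

      -- Distinct parts have distinct target parts, so a common value is a terminal; each map
      -- reaches `s` only from `t` and `t` only from `s`.
      rᵢ-cross-injective : ∀ i j u v → proj₁ (rᵢ i u) ≡ proj₁ (rᵢ j v) → proj₁ u ≡ proj₁ v
      rᵢ-cross-injective i j u v eq with i ≟ j
      ... | yes refl = cong proj₁ (rᵢ-injective i eq)
      ... | no i≢j with shared-terminal (i≢j ∘ τ-injective) (proj₂ (rᵢ i u))
                          (subst (_∈ V (Gs (τ j))) (sym eq) (proj₂ (rᵢ j v)))
      ...   | inj₁ ↦s = trans (source-preimage i u ↦s)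
                              (sym (source-preimage j v (trans (sym eq) ↦s)))
      ...   | inj₂ ↦t = trans (target-preimage i u ↦t)
                              (sym (target-preimage j v (trans (sym eq) ↦t)))

      r-injective : ∀ {u v} → r u ≡ r v → u ≡ v
      r-injective {u} {v} eq with in-part u | in-part v
      ... | i , u′ , refl | j , v′ , refl = vertex-≡ (rᵢ-cross-injective i j u′ v′
        (cong proj₁ (trans (sym (r-include i u′)) (trans eq (r-include j v′)))))

      r-preimage : ∀ j {y} (y∈ : y ∈ V (Gs j)) →
        ∃[ u ] proj₁ (rᵢ (π ⟨$⟩ˡ j) u) ≡ y
      r-preimage j {y} y∈
        with u , eq ← proj₂ (proj₁ (iso (π ⟨$⟩ˡ j)))
                        -- The part of index `π ⟨$⟩ˡ j` is mapped onto the part of index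
                        -- `τ (π ⟨$⟩ˡ j)`, which has to be identified with `j`.
                        (y , subst (λ k → y ∈ V (Gs k)) (sym (inverseʳ π)) y∈) =
        u , cong proj₁ (eq refl)

      r-surjective : ∀ v → ∃[ u ] r u ≡ v
      r-surjective (y , y∈) with j , y∈ⱼ ← part-of y∈ with u , eq ← r-preimage j y∈ⱼ =
        include (π ⟨$⟩ˡ j) u , trans (r-include _ u) (vertex-≡ eq)

      r-adj : ∀ u v → Adj G (proj₁ u) (proj₁ v) → Adj G (proj₁ (r u)) (proj₁ (r v))
      r-adj u v a with i , aᵢ ← Equivalence.to (IsUnion.edges union _ _) a =
        subst₂ (Adj G) (sym (restricts i _ _ (adj⇒∈ˡ (Gs i) aᵢ)))
                       (sym (restricts i _ _ (adj⇒∈ʳ (Gs i) aᵢ)))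
          (part-adj (τ i) (Equivalence.to (proj₂ (iso i) _ _) aᵢ))

      -- The edge between the images lies in some part `j` and is pulled back through the
      -- isomorphism onto that part; injectivity of `r` then identifies the endpoints found there
      -- with `u` and `v`.
      r-adj⁻ : ∀ u v → Adj G (proj₁ (r u)) (proj₁ (r v)) → Adj G (proj₁ u) (proj₁ v)
      r-adj⁻ u v a with j , aⱼ ← Equivalence.to (IsUnion.edges union _ _) a
        with u′ , eqᵤ ← r-preimage j (adj⇒∈ˡ (Gs j) aⱼ)
           | v′ , eqᵥ ← r-preimage j (adj⇒∈ʳ (Gs j) aⱼ) =
        subst₂ (Adj G) (back u u′ eqᵤ) (back v v′ eqᵥ)
          (part-adj (π ⟨$⟩ˡ j) (Equivalence.from (proj₂ (iso (π ⟨$⟩ˡ j)) u′ v′)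
            (subst₂ (Adj (Gs (τ (π ⟨$⟩ˡ j)))) (sym eqᵤ) (sym eqᵥ)
              (subst (λ k → Adj (Gs k) _ _) (sym (inverseʳ π)) aⱼ))))
        where
        back : ∀ {i} w w′ → proj₁ (rᵢ i w′) ≡ proj₁ (r w) → proj₁ w′ ≡ proj₁ w
        back w w′ eq = cong proj₁ (r-injective (trans (r-include _ w′) (vertex-≡ eq)))

      restriction-swaps : AutSwap P r
      restriction-swaps =
        ((r-injective , λ v → proj₁ (r-surjective v) , λ { refl → proj₂ (r-surjective v) }) ,
         λ u v → mk⇔ (r-adj u v) (r-adj⁻ u v)) ,
        r-source , r-target

  -- From an automorphism exchanging the terminals to a reversal.

  module Swap (np : ∀ i → NonParallel (Ps i)) where

    private
      shapeᵢ : ∀ i → Shape (Gs i) s t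
      shapeᵢ i = shape (Ps i) (np i)

    module Image (f : Vertex G → Vertex G) (f-swap : AutSwap P f) where

      f-injective : ∀ {u v} → f u ≡ f v → u ≡ v
      f-injective = proj₁ (proj₁ (proj₁ f-swap))

      f-adj : ∀ {u v} → Adj G (proj₁ u) (proj₁ v) → Adj G (proj₁ (f u)) (proj₁ (f v))
      f-adj {u} {v} = Equivalence.to (proj₂ (proj₁ f-swap) u v)

      terminal-image : ∀ {v} → Terminal s t (proj₁ v) → Terminal s t (proj₁ (f v))
      terminal-image (inj₁ refl) =
        inj₂ (cong proj₁ (trans (cong f (vertex-≡ refl)) (proj₁ (proj₂ f-swap))))
      terminal-image (inj₂ refl) =
        inj₁ (cong proj₁ (trans (cong f (vertex-≡ refl)) (proj₂ (proj₂ f-swap))))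

      interior-image : ∀ {v} → ¬ Terminal s t (proj₁ v) → ¬ Terminal s t (proj₁ (f v))
      interior-image v∉ (inj₁ eq) = v∉ (inj₂ (cong proj₁ (f-injective
        (trans (vertex-≡ eq) (sym (proj₂ (proj₂ f-swap)))))))
      interior-image v∉ (inj₂ eq) = v∉ (inj₁ (cong proj₁ (f-injective
        (trans (vertex-≡ eq) (sym (proj₁ (proj₂ f-swap)))))))

      -- An index of a part containing the image of x; junk if x is not a vertex of G.
      colour : Fin n → Fin (2 + m)
      colour x with x ∈? V G
      ... | yes x∈ = proj₁ (part-of (proj₂ (f (x , x∈))))
      ... | no  _  = zero

      colour∈ : ∀ v → proj₁ (f v) ∈ V (Gs (colour (proj₁ v)))
      colour∈ (x , x∈) with x ∈? V G
      -- `colour` evaluates `f` at the membership proof found by its own test, which must be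
      -- identified with `x∈`.
      ... | yes x∈′ rewrite vertex-≡ {p = V G} {x , x∈} {x , x∈′} refl =
        proj₂ (part-of (proj₂ (f (x , x∈′))))
      ... | no  x∉  = contradiction x∈ x∉

      τ : Fin (2 + m) → Fin (2 + m)
      τ i with shapeᵢ i
      -- Several parts may be copies of the edge between `s` and `t`, which `f` cannot tell apart;
      -- fixing each index keeps `τ` invertible.
      ... | bare-edge _ _ = i
      ... | proper w _ _ _ _ = colour w

      τ-edge : ∀ i → (∀ {x} → x ∈ V (Gs i) → Terminal s t x) → τ i ≡ i
      τ-edge i no-interior with shapeᵢ i
      ... | bare-edge _ _ = refl
      ... | proper _ w∈ w∉ _ _ = contradiction (no-interior w∈) w∉

      -- The image edge lies in one part `j`, and the images of interior vertices are interior,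
      -- hence in no other part; both colours are therefore `j`.
      colour-adj : ∀ i {x y} → Adj (Gs i) x y →
        ¬ Terminal s t x → ¬ Terminal s t y → colour x ≡ colour y
      colour-adj i a x∉ y∉
        with j , aⱼ ← Equivalence.to (IsUnion.edges union _ _)
               (f-adj {_ , part⊆ i (adj⇒∈ˡ (Gs i) a)} {_ , part⊆ i (adj⇒∈ʳ (Gs i) a)}
                      (part-adj i a)) =
        trans (part-unique (interior-image x∉) (colour∈ _) (adj⇒∈ˡ (Gs j) aⱼ))
              (part-unique (interior-image y∉) (adj⇒∈ʳ (Gs j) aⱼ) (colour∈ _))

      -- Terminals lie in every part. On the interior, which is connected, `colour` is constant and
      -- so equals its value at the representative `w`, which is `τ i`.
      image : ∀ i v → proj₁ (f (include i v)) ∈ V (Gs (τ i))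
      image i v@(x , x∈) with terminal? s t x
      ... | yes Tx = terminal∈ (Ps (τ i)) (terminal-image Tx)
      ... | no x∉ with shapeᵢ i
      ...   | bare-edge no-interior _ = contradiction (no-interior x∈) x∉
      ...   | proper w w∈ w∉ _ conn =
        subst (λ k → _ ∈ V (Gs k)) (conn colour (colour-adj i) x∈ w∈ x∉ w∉) (colour∈ _)

      -- The image edge lies in some part `j`. An interior endpoint forces `j` to be `τ i`; if both
      -- endpoints are terminals, part `i` is a bare edge and `τ i` is `i`.
      adj-image : ∀ i u v → Adj (Gs i) (proj₁ u) (proj₁ v) →
        Adj (Gs (τ i)) (proj₁ (f (include i u))) (proj₁ (f (include i v)))
      adj-image i u v a
        with j , aⱼ ← Equivalence.to (IsUnion.edges union _ _)
               (f-adj {include i u} {include i v} (part-adj i a))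
        with terminal? s t (proj₁ u) | terminal? s t (proj₁ v)
      ... | no u∉ | _ = subst (λ k → Adj (Gs k) _ _)
        (part-unique (interior-image u∉) (adj⇒∈ˡ (Gs j) aⱼ) (image i u)) aⱼ
      ... | yes _ | no v∉ = subst (λ k → Adj (Gs k) _ _)
        (part-unique (interior-image v∉) (adj⇒∈ʳ (Gs j) aⱼ) (image i v)) aⱼ
      ... | yes Tu | yes Tv with shapeᵢ i
      ...   | bare-edge no-interior st =
        terminals-adjacent (Gs i) st (terminal-image Tu) (terminal-image Tv) (adj⇒≢ (Gs j) aⱼ)
      ...   | proper _ _ _ not-st _ = contradiction (adjacent-terminals (Gs i) Tu Tv a) not-st

    open Image

    module _ {f g} (f-swap : AutSwap P f) (g-swap : AutSwap P g)
      (gf : ∀ v → g (f v) ≡ v) where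

      include-image : ∀ i v →
        g (include (τ f f-swap i) (proj₁ (f (include i v)) , image f f-swap i v)) ≡ include i v
      include-image i v = trans (cong g (vertex-≡ refl)) (gf (include i v))

      -- Both maps fix the index of a bare edge. Otherwise `g` after `f` returns the interior vertex
      -- `w` to itself, so `w` lies in part `i` and in the part reached by both index maps, and
      -- these coincide.
      τ-inverse : ∀ i → τ g g-swap (τ f f-swap i) ≡ i
      τ-inverse i = by-shape (shapeᵢ i)
        where
        by-shape : Shape (Gs i) s t → τ g g-swap (τ f f-swap i) ≡ i
        by-shape (bare-edge no-interior _) =
          trans (cong (τ g g-swap) (τ-edge f f-swap i no-interior))
                (τ-edge g g-swap i no-interior)
        by-shape (proper w w∈ w∉ _ _) = part-unique w∉
          (subst (_∈ V (Gs (τ g g-swap (τ f f-swap i))))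
                 (cong proj₁ (include-image i (w , w∈)))
                 (image g g-swap (τ f f-swap i) (_ , image f f-swap i (w , w∈))))
          w∈

    swap⇒reversal : ∀ {f} → AutSwap P f → Reversal Ps
    swap⇒reversal {f} f-swap with g , g-swap , fg , gf ← swap-inverse P f-swap = record
      { τ   = permutation τf τg (τ-inverse g-swap f-swap fg) (τ-inverse f-swap g-swap gf)
      ; r   = rᵢ
      ; iso = λ i → ((λ eq → vertex-≡ (cong proj₁ (f-injective f f-swap
                               {include i _} {include i _} (vertex-≡ (cong proj₁ eq))))) ,
                     λ v → preimage i v , λ { refl → vertex-≡ (cong proj₁
                       (trans (cong f (vertex-≡ refl)) (fg (include (τf i) v)))) }) ,
                    λ u v → mk⇔ (adj-image f f-swap i u v) (rᵢ-adj⁻ i u v)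
      ; s↦t = λ i → vertex-≡ (cong proj₁ (trans (cong f (vertex-≡ refl)) (proj₁ (proj₂ f-swap))))
      ; t↦s = λ i → vertex-≡ (cong proj₁ (trans (cong f (vertex-≡ refl)) (proj₂ (proj₂ f-swap))))
      }
      where
      τf = τ f f-swap
      τg = τ g g-swap

      rᵢ : ∀ i → Vertex (Gs i) → Vertex (Gs (τf i))
      rᵢ i v = proj₁ (f (include i v)) , image f f-swap i v

      preimage : ∀ i → Vertex (Gs (τf i)) → Vertex (Gs i)
      preimage i v = proj₁ (g (include (τf i) v)) ,
        -- `g` sends part `τf i` into part `τg (τf i)`, which is part `i`.
        subst (λ k → proj₁ (g (include (τf i) v)) ∈ V (Gs k))
          (τ-inverse f-swap g-swap gf i) (image g g-swap (τf i) v)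

      -- `adj-image` for the inverse `g` carries the edge back into part `τg (τf i)`, that is `i`,
      -- and `g` undoes `f` at both endpoints.
      rᵢ-adj⁻ : ∀ i u v → Adj (Gs (τf i)) (proj₁ (rᵢ i u)) (proj₁ (rᵢ i v)) →
        Adj (Gs i) (proj₁ u) (proj₁ v)
      rᵢ-adj⁻ i u v a = subst₂ (Adj (Gs i))
        (cong proj₁ (include-image f-swap g-swap gf i u))
        (cong proj₁ (include-image f-swap g-swap gf i v))
        (subst (λ k → Adj (Gs k) _ _) (τ-inverse f-swap g-swap gf i)
          (adj-image g g-swap (τf i) (rᵢ i u) (rᵢ i v) a))

theorem6p5 : ∀ {n m : ℕ} (G : Graph n) (s t : Fin n)
    (Gs : Fin (2 + m) → Graph n)
    (Ps : ∀ i → OrientedSP (Gs i) s t)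
    (c : ParallelComposition G s t Gs) →
    (∀ i → NonParallel (Ps i)) →
    let P = parallel Gs Ps c in
    (∀ (ρ : Reversal Ps) →
    (∃[ r ] RestrictsTo {G = G} r ρ) ×
    (∀ (r : Vertex G → Vertex G) → RestrictsTo {G = G} r ρ →
    AutSemi P ≐ WithTranslate r (AutOr P))) ×
    (¬ Reversal Ps → AutSemi P ≐ AutOr P)
theorem6p5 G s t Gs Ps c np =
  (λ ρ → glue ρ , λ r restricts → semi≐or∪swap∘or P (restriction-swaps ρ r restricts)) ,
  λ no-reversal →
    (λ f-semi → [ id , (λ f-swap → contradiction (swap⇒reversal f-swap) no-reversal) ]′
                  (semi⇒or⊎swap P f-semi)) ,
    or⇒semi P
  where
  open Parallel Ps c
  open FromReversal
  open Swap np
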